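{- Let \(m\) be a positive integer that is not a perfect square, and let \(a,b,c\) be positive integers with \(\gcd(am,b^2-c^2m)=1\). Then \[Frob(a\sqrt m,\,b+c\sqrt m)=(a\sqrt m-1)(b+c\sqrt m-1)(1+\sqrt m)+\mathbb N[\sqrt m].\]
   Context: \(\mathbb N\) denotes the set of non-negative integers. \(\mathbb Z[\sqrt m]=\{u+v\sqrt m\mid u,v\in\mathbb Z\}\) and \(\mathbb N[\sqrt m]=\{u+v\sqrt m\mid u,v\in\mathbb N\}\). For \(\alpha_1,\alpha_2\in\mathbb Z[\sqrt m]\), \(SG(\alpha_1,\alpha_2)=\{\lambda_1\alpha_1+\lambda_2\alpha_2\mid \lambda_1,\lambda_2\in\mathbb N[\sqrt m]\}\) and \(Frob(\alpha_1,\alpha_2)=\{w\in\mathbb Z[\sqrt m]\mid w+\mathbb N[\sqrt m]\subseteq SG(\alpha_1,\alpha_2)\}\). -}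

module Defs where

open import Data.Nat.Base as ℕ using (ℕ)
open import Data.Integer.Base as ℤ using (ℤ; +_; 0ℤ; 1ℤ)
open import Data.Product.Base using (_×_; ∃-syntax)
open import Level using (0ℓ)
open import Relation.Binary.PropositionalEquality using (_≡_)
open import Relation.Unary using (Pred; _∈_; _⊆_)

infixl 7 _*_
infixl 6 _+_ _-_ _+ˢ_
infix  8 -_

IsPerfectSquare : ℕ → Set
IsPerfectSquare n = ∃[ k ] n ≡ k ℕ.^ 2

-- The element u + v√m is stored as its pair of coordinates; for m not a
-- perfect square these are unique, so _≡_ is equality of the numbers.
record ℤ[√_] (m : ℕ) : Set where
  constructor ⟨_,_⟩
  field
    u v : ℤ

_+_ : ∀ {m} → ℤ[√ m ] → ℤ[√ m ] → ℤ[√ m ]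
⟨ u , v ⟩ + ⟨ u′ , v′ ⟩ = ⟨ u ℤ.+ u′ , v ℤ.+ v′ ⟩

-_ : ∀ {m} → ℤ[√ m ] → ℤ[√ m ]
- ⟨ u , v ⟩ = ⟨ ℤ.- u , ℤ.- v ⟩

_-_ : ∀ {m} → ℤ[√ m ] → ℤ[√ m ] → ℤ[√ m ]
x - y = x + (- y)

_*_ : ∀ {m} → ℤ[√ m ] → ℤ[√ m ] → ℤ[√ m ]
_*_ {m} ⟨ u , v ⟩ ⟨ u′ , v′ ⟩ =
  ⟨ u ℤ.* u′ ℤ.+ + m ℤ.* (v ℤ.* v′) , u ℤ.* v′ ℤ.+ v ℤ.* u′ ⟩

ι : ∀ {m} → ℕ → ℤ[√ m ]
ι n = ⟨ + n , 0ℤ ⟩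

√ : ∀ m → ℤ[√ m ]
√ m = ⟨ 0ℤ , 1ℤ ⟩

ℕ[√_] : ∀ m → Pred ℤ[√ m ] 0ℓ
ℕ[√ m ] x = ∃[ u ] ∃[ v ] x ≡ ι u + ι v * √ m

_+ˢ_ : ∀ {m} → ℤ[√ m ] → Pred ℤ[√ m ] 0ℓ → Pred ℤ[√ m ] 0ℓ
(x +ˢ P) y = ∃[ z ] z ∈ P × y ≡ x + z

SG : ∀ {m} → ℤ[√ m ] → ℤ[√ m ] → Pred ℤ[√ m ] 0ℓ
SG {m} α₁ α₂ x =
  ∃[ λ₁ ] ∃[ λ₂ ] λ₁ ∈ ℕ[√ m ] × λ₂ ∈ ℕ[√ m ] × x ≡ λ₁ * α₁ + λ₂ * α₂

Frob : ∀ {m} → ℤ[√ m ] → ℤ[√ m ] → Pred ℤ[√ m ] 0ℓ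
Frob {m} α₁ α₂ w = w +ˢ ℕ[√ m ] ⊆ SG α₁ α₂

{-# OPTIONS --safe #-}

-- Write α = a√m and β = b + c√m. The ideal (α) is amℤ + a√mℤ, and β is
-- invertible modulo α because its norm b² − c²m is prime to am. Hence every
-- element is congruent modulo α to λβ for exactly one λ = s + t√m in the box
-- 0 ≤ s < am, 0 ≤ t < a. Let G be the value of λβ at the corner
-- (am − 1, a − 1) of the box. The generator in the theorem is
-- G − (am − 1) − (a − 1)√m. Above it, w − λβ lies in (α) and has coordinates
-- greater than −am and −a, so it is a nonnegative multiple of α. Conversely,
-- λ ∈ ℕ[√m] with λβ ≡ G has λ ≥ corner, so an element of SG(α, β) congruent
-- to G is coordinatewise at least G; this excludes the elements whose first
-- (second) coordinate falls short of that of G by am (by a), however large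
-- the other coordinate is.

module Submission where

module Arithmetic where

  open import Data.Integer.Base
  open import Data.Integer.DivMod using (_%ℕ_; _/ℕ_; n%ℕd<d; a≡a%ℕn+[a/ℕn]*n)
  open import Data.Integer.Divisibility.Signed using (_∣_; divides; ∣⇒∣ᵤ)
  open import Data.Integer.GCD using (gcd)
  open import Data.Integer.Properties
  open import Data.Integer.Tactic.RingSolver using (solve-∀)
  open import Data.Nat.Base as ℕ using (ℕ)
  import Data.Nat.Divisibility as ℕ
  import Data.Nat.GCD as ℕ
  open import Data.Product.Base using (_×_; _,_; proj₁; proj₂; ∃-syntax)
  open import Data.Sum.Base using (inj₁; inj₂)
  open import Relation.Binary.PropositionalEquality

  -- Bézout coefficients, progressions and residues in ℤ.

  i+j-j≡i : ∀ i j → i + j - j ≡ i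
  i+j-j≡i = solve-∀

  j≡i+[j-i] : ∀ i j → j ≡ i + (j - i)
  j≡i+[j-i] = solve-∀

  i-d-i≡-1*d : ∀ i d → i - d - i ≡ -1ℤ * d
  i-d-i≡-1*d = solve-∀

  i+j-i≡j : ∀ i j → i + j - i ≡ j
  i+j-i≡j = solve-∀

  +∣i∣≡k*i : ∀ i → ∃[ k ] + ∣ i ∣ ≡ k * i
  +∣i∣≡k*i i with +∣i∣≡i⊎+∣i∣≡-i i
  ... | inj₁ eq = 1ℤ , trans eq (sym (*-identityˡ i))
  ... | inj₂ eq = -1ℤ , trans eq (sym (-1*i≡-i i))

  -- The identity over ℕ concerns `∣ i ∣` and `∣ j ∣`. Each is an integer multiple of `i` or `j`, so
  -- the signs are absorbed into the coefficients.
  bézout : ∀ i j → gcd i j ≡ 1ℤ → ∃[ x ] ∃[ y ] x * i + y * j ≡ 1ℤ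
  bézout i j eq
    with k , ∣i∣≡ki ← +∣i∣≡k*i i | l , ∣j∣≡lj ← +∣i∣≡k*i j
    with ℕ.Bézout.identity (subst (ℕ.GCD ∣ i ∣ ∣ j ∣) (+-injective eq) (ℕ.gcd-GCD ∣ i ∣ ∣ j ∣))
  ... | ℕ.Bézout.+- x y e = + x * k , - (+ y * l) , (begin
        + x * k * i + - (+ y * l) * j     ≡⟨ regroup (+ x) k i (+ y) l j ⟩
        + x * (k * i) - + y * (l * j)     ≡⟨ cong₂ (λ p q → + x * p - + y * q) ∣i∣≡ki ∣j∣≡lj ⟨
        + x * + ∣ i ∣ - + y * + ∣ j ∣     ≡⟨ cong₂ _-_ (pos-* x ∣ i ∣) (pos-* y ∣ j ∣) ⟨
        + (x ℕ.* ∣ i ∣) - + (y ℕ.* ∣ j ∣) ≡⟨ cong (λ n → + n - + (y ℕ.* ∣ j ∣)) e ⟨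
        1ℤ + + (y ℕ.* ∣ j ∣) - + (y ℕ.* ∣ j ∣) ≡⟨ i+j-j≡i 1ℤ (+ (y ℕ.* ∣ j ∣)) ⟩
        1ℤ                                ∎)
    where
    open ≡-Reasoning
    regroup : ∀ x k i y l j → x * k * i + - (y * l) * j ≡ x * (k * i) - y * (l * j)
    regroup = solve-∀
  ... | ℕ.Bézout.-+ x y e = - (+ x * k) , + y * l , (begin
        - (+ x * k) * i + + y * l * j     ≡⟨ regroup (+ x) k i (+ y) l j ⟩
        + y * (l * j) - + x * (k * i)     ≡⟨ cong₂ (λ p q → + y * q - + x * p) ∣i∣≡ki ∣j∣≡lj ⟨
        + y * + ∣ j ∣ - + x * + ∣ i ∣     ≡⟨ cong₂ _-_ (pos-* y ∣ j ∣) (pos-* x ∣ i ∣) ⟨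
        + (y ℕ.* ∣ j ∣) - + (x ℕ.* ∣ i ∣) ≡⟨ cong (λ n → + n - + (x ℕ.* ∣ i ∣)) e ⟨
        1ℤ + + (x ℕ.* ∣ i ∣) - + (x ℕ.* ∣ i ∣) ≡⟨ i+j-j≡i 1ℤ (+ (x ℕ.* ∣ i ∣)) ⟩
        1ℤ                                ∎)
    where
    open ≡-Reasoning
    regroup : ∀ x k i y l j → - (x * k) * i + y * l * j ≡ y * (l * j) - x * (k * i)
    regroup = solve-∀

  i≤j⇒j≡i+n : ∀ {i j} → i ≤ j → ∃[ n ] j ≡ i + + n
  i≤j⇒j≡i+n {i} {j} i≤j = ∣ j - i ∣ , (begin
    j               ≡⟨ j≡i+[j-i] i j ⟩
    i + (j - i)     ≡⟨ cong (_+_ i) (0≤i⇒+∣i∣≡i (i≤j⇒0≤j-i i≤j)) ⟨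
    i + + ∣ j - i ∣ ∎)
    where
    open ≡-Reasoning

  i-d<i : ∀ i d .{{_ : Positive d}} → i - d < i
  i-d<i i d@(+[1+ _ ]) = subst (i - d <_) (+-identityʳ i) (+-monoʳ-< i -<+)

  i≤+∣i∣ : ∀ i → i ≤ + ∣ i ∣
  i≤+∣i∣ (+ n)    = ≤-refl
  i≤+∣i∣ -[1+ n ] = -≤+

  -- Lets one coordinate grow past any bound while its residue class stays fixed. Since `d ≥ 1`,
  -- `∣ j - i ∣` steps suffice.
  ∃-progression≥ : ∀ d .{{_ : Positive d}} i j → ∃[ k ] j ≤ i + k * d
  ∃-progression≥ d@(+[1+ _ ]) i j = + n , (begin
    j            ≡⟨ j≡i+[j-i] i j ⟩
    i + (j - i)  ≤⟨ +-monoʳ-≤ i (i≤+∣i∣ (j - i)) ⟩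
    i + + n      ≡⟨ cong (_+_ i) (*-identityʳ (+ n)) ⟨
    i + + n * 1ℤ ≤⟨ +-monoʳ-≤ i (*-monoˡ-≤-nonNeg (+ n) (+≤+ (ℕ.s≤s ℕ.z≤n))) ⟩
    i + + n * d  ∎)
    where
    open ≤-Reasoning
    n = ∣ j - i ∣

  -- The bound has the form `d - 1ℤ` because this is a coordinate of the corner of the box when `d`
  -- is am or a.
  residue : ∀ d .{{_ : Positive d}} i → ∃[ r ] ∃[ q ] + r ≤ d - 1ℤ × i ≡ + r + q * d
  residue d@(+[1+ k ]) i = i %ℕ ℕ.suc k , i /ℕ ℕ.suc k , r≤d-1 , a≡a%ℕn+[a/ℕn]*n i (ℕ.suc k)
    where
    r≤d-1 : + (i %ℕ ℕ.suc k) ≤ d - 1ℤ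
    r≤d-1 = i<j⇒i≤pred[j] (+<+ (n%ℕd<d i (ℕ.suc k)))

  pos⇒nonNeg : ∀ i .{{_ : Positive i}} → NonNegative i
  pos⇒nonNeg +[1+ _ ] = _

  -d<q*d⇒q≡+n : ∀ d .{{_ : Positive d}} q → - d < q * d → ∃[ n ] q ≡ + n
  -d<q*d⇒q≡+n d q lt = ∣ q ∣ , sym (0≤i⇒+∣i∣≡i (i<j⇒suc[i]≤j -1<q))
    where
    -1<q : -1ℤ < q
    -1<q = *-cancelʳ-<-nonNeg d {{pos⇒nonNeg d}} (subst (_< q * d) (sym (-1*i≡-i d)) lt)

  -- From `l ≤ g` it follows that `i - l` exceeds `- d`; a multiple of `d` greater than `- d` is a
  -- nonnegative multiple.
  d∣i-l∧i>g-d⇒i≡n*d+l : ∀ d .{{_ : Positive d}} g i l →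
                        g - d < i → l ≤ g → d ∣ i - l → ∃[ n ] i ≡ + n * d + l
  d∣i-l∧i>g-d⇒i≡n*d+l d g i l g-d<i l≤g (divides q i-l≡qd) =
    let n , q≡n = -d<q*d⇒q≡+n d q -d<qd
    in n , trans (split i l) (cong (_+ l) (trans i-l≡qd (cong (_* d) q≡n)))
    where
    open ≤-Reasoning
    cancel : ∀ g d → - d ≡ g - d - g
    cancel = solve-∀
    split : ∀ i l → i ≡ i - l + l
    split = solve-∀
    -d<qd : - d < q * d
    -d<qd = begin-strict
      - d       ≡⟨ cancel g d ⟩
      g - d - g <⟨ +-monoˡ-< (- g) g-d<i ⟩
      i - g     ≤⟨ +-monoʳ-≤ i (neg-mono-≤ l≤g) ⟩
      i - l     ≡⟨ i-l≡qd ⟩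
      q * d     ∎

  d∣1+n⇒d-1≤n : ∀ d .{{_ : Positive d}} n → d ∣ 1ℤ + + n → d - 1ℤ ≤ + n
  d∣1+n⇒d-1≤n +[1+ k ] n d∣1+n = +≤+ (ℕ.s≤s⁻¹ (ℕ.∣⇒≤ (∣⇒∣ᵤ d∣1+n)))

  linear-mono-≤ : ∀ p q .{{_ : NonNegative p}} .{{_ : NonNegative q}} s s′ t t′ →
                  s ≤ s′ → t ≤ t′ → s * p + t * q ≤ s′ * p + t′ * q
  linear-mono-≤ p q s s′ t t′ s≤s′ t≤t′ = +-mono-≤ (*-monoʳ-≤-nonNeg p s≤s′) (*-monoʳ-≤-nonNeg q t≤t′)

  pos*pos⇒pos : ∀ i j .{{_ : Positive i}} .{{_ : Positive j}} → Positive (i * j)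
  pos*pos⇒pos +[1+ _ ] +[1+ _ ] = _

  nonNeg*nonNeg⇒nonNeg : ∀ i j .{{_ : NonNegative i}} .{{_ : NonNegative j}} → NonNegative (i * j)
  nonNeg*nonNeg⇒nonNeg (+ k) (+ l) = subst NonNegative (pos-* k l) _

  -- The coordinates of (s + t√m)(b + c√m).
  re im : (m b c s t : ℤ) → ℤ
  re m b c s t = s * b + t * (c * m)
  im m b c s t = s * c + t * b

  -- U + V√m = (x + y√m) a√m + (s + t√m)(b + c√m).
  record Representable (a m b c U V : ℤ) : Set where
    constructor representation
    field
      x y s t : ℕ
      U≡ : U ≡ + y * (a * m) + re m b c (+ s) (+ t)
      V≡ : V ≡ + x * a + im m b c (+ s) (+ t)

  -- Multiplication by b + c√m modulo a√m.

  module Corner (a m b c : ℤ) where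

    -- The coordinates of G. They stand outside `Box` so that the generator can be computed without
    -- positivity or Bézout data.
    ReG ImG : ℤ
    ReG = re m b c (a * m - 1ℤ) (a - 1ℤ)
    ImG = im m b c (a * m - 1ℤ) (a - 1ℤ)

  module Box (a m b c : ℤ)
             .{{_ : Positive a}} .{{_ : Positive m}}
             .{{_ : NonNegative b}} .{{_ : NonNegative c}}
             (x y : ℤ) (bézout-norm : x * (a * m) + y * (b ^ 2 - c ^ 2 * m) ≡ 1ℤ)
             where

    private
      instance
        _ = pos*pos⇒pos a m
        _ = pos⇒nonNeg m
        _ = nonNeg*nonNeg⇒nonNeg c m

    open Corner a m b c

    by-bézout : ∀ i → i ≡ i * (x * (a * m) + y * (b ^ 2 - c ^ 2 * m))
    by-bézout i = trans (sym (*-identityʳ i)) (cong (_*_ i) (sym bézout-norm))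

    -- Multiply s + t√m by b + c√m and then by its conjugate.
    β*-injective-mod-α : ∀ s t → a * m ∣ re m b c s t → a ∣ im m b c s t → (a * m ∣ s) × (a ∣ t)
    β*-injective-mod-α s t (divides p re≡) (divides q im≡) =
      divides (s * x + y * (p * b - q * c)) (begin
        s ≡⟨ by-bézout s ⟩
        s * (x * (a * m) + y * (b ^ 2 - c ^ 2 * m)) ≡⟨ conj-re a m b c x y s t ⟩
        s * x * (a * m) + y * (re m b c s t * b - im m b c s t * (c * m))
          ≡⟨ cong₂ (λ r i → s * x * (a * m) + y * (r * b - i * (c * m))) re≡ im≡ ⟩
        s * x * (a * m) + y * (p * (a * m) * b - q * a * (c * m)) ≡⟨ factor-re a m b c x y s p q ⟩
        (s * x + y * (p * b - q * c)) * (a * m) ∎) ,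
      divides (t * x * m + y * (q * b - p * m * c)) (begin
        t ≡⟨ by-bézout t ⟩
        t * (x * (a * m) + y * (b ^ 2 - c ^ 2 * m)) ≡⟨ conj-im a m b c x y s t ⟩
        t * x * (a * m) + y * (im m b c s t * b - re m b c s t * c)
          ≡⟨ cong₂ (λ r i → t * x * (a * m) + y * (i * b - r * c)) re≡ im≡ ⟩
        t * x * (a * m) + y * (q * a * b - p * (a * m) * c) ≡⟨ factor-im a m b c x y t p q ⟩
        (t * x * m + y * (q * b - p * m * c)) * a ∎)
      where
      open ≡-Reasoning
      -- Here b ^ 2 is unfolded because solve-∀ fails on integer powers.
      conj-re : ∀ a m b c x y s t → s * (x * (a * m) + y * (b * (b * 1ℤ) - c * (c * 1ℤ) * m))
              ≡ s * x * (a * m) + y * ((s * b + t * (c * m)) * b - (s * c + t * b) * (c * m))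
      conj-re = solve-∀
      conj-im : ∀ a m b c x y s t → t * (x * (a * m) + y * (b * (b * 1ℤ) - c * (c * 1ℤ) * m))
              ≡ t * x * (a * m) + y * ((s * c + t * b) * b - (s * b + t * (c * m)) * c)
      conj-im = solve-∀
      factor-re : ∀ a m b c x y s p q → s * x * (a * m) + y * (p * (a * m) * b - q * a * (c * m))
                ≡ (s * x + y * (p * b - q * c)) * (a * m)
      factor-re = solve-∀
      factor-im : ∀ a m b c x y t p q → t * x * (a * m) + y * (q * a * b - p * (a * m) * c)
                ≡ (t * x * m + y * (q * b - p * m * c)) * a
      factor-im = solve-∀

    -- The inverse of b + c√m modulo α is y times its conjugate.
    β*-surjective-mod-α : ∀ U V → ∃[ s ] ∃[ t ]
      + s ≤ a * m - 1ℤ × + t ≤ a - 1ℤ ×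
      (a * m ∣ U - re m b c (+ s) (+ t)) × (a ∣ V - im m b c (+ s) (+ t))
    β*-surjective-mod-α U V
      -- The numbers divided are the coordinates of y(U + V√m)(b - c√m). Passing to remainders
      -- changes this by q·am + r·a√m, an element of (α).
      with s , q , s≤ , s₀≡ ← residue (a * m) (y * (U * b - V * (c * m)))
         | t , r , t≤ , t₀≡ ← residue a (y * (V * b - U * c)) =
      s , t , s≤ , t≤ ,
      divides (U * x + q * b + r * c) (begin
        U - re m b c (+ s) (+ t) ≡⟨ shift-re a m b c U (+ s) (+ t) q r ⟩
        U - re m b c (+ s + q * (a * m)) (+ t + r * a) + (q * b + r * c) * (a * m)
          ≡⟨ cong₂ (λ s t → U - re m b c s t + (q * b + r * c) * (a * m)) s₀≡ t₀≡ ⟨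
        U - re m b c s₀ t₀ + (q * b + r * c) * (a * m)
          ≡⟨ cong (λ z → z - re m b c s₀ t₀ + (q * b + r * c) * (a * m)) (by-bézout U) ⟩
        U * (x * (a * m) + y * (b ^ 2 - c ^ 2 * m)) - re m b c s₀ t₀ + (q * b + r * c) * (a * m)
          ≡⟨ factor-re a m b c x y U V q r ⟩
        (U * x + q * b + r * c) * (a * m) ∎) ,
      divides (V * x * m + q * m * c + r * b) (begin
        V - im m b c (+ s) (+ t) ≡⟨ shift-im a m b c V (+ s) (+ t) q r ⟩
        V - im m b c (+ s + q * (a * m)) (+ t + r * a) + (q * m * c + r * b) * a
          ≡⟨ cong₂ (λ s t → V - im m b c s t + (q * m * c + r * b) * a) s₀≡ t₀≡ ⟨
        V - im m b c s₀ t₀ + (q * m * c + r * b) * a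
          ≡⟨ cong (λ z → z - im m b c s₀ t₀ + (q * m * c + r * b) * a) (by-bézout V) ⟩
        V * (x * (a * m) + y * (b ^ 2 - c ^ 2 * m)) - im m b c s₀ t₀ + (q * m * c + r * b) * a
          ≡⟨ factor-im a m b c x y U V q r ⟩
        (V * x * m + q * m * c + r * b) * a ∎)
      where
      open ≡-Reasoning
      s₀ = y * (U * b - V * (c * m))
      t₀ = y * (V * b - U * c)
      shift-re : ∀ a m b c U s t q r → U - (s * b + t * (c * m))
        ≡ U - ((s + q * (a * m)) * b + (t + r * a) * (c * m)) + (q * b + r * c) * (a * m)
      shift-re = solve-∀
      shift-im : ∀ a m b c V s t q r → V - (s * c + t * b)
        ≡ V - ((s + q * (a * m)) * c + (t + r * a) * b) + (q * m * c + r * b) * a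
      shift-im = solve-∀
      factor-re : ∀ a m b c x y U V q r →
        U * (x * (a * m) + y * (b * (b * 1ℤ) - c * (c * 1ℤ) * m))
          - (y * (U * b - V * (c * m)) * b + y * (V * b - U * c) * (c * m)) + (q * b + r * c) * (a * m)
        ≡ (U * x + q * b + r * c) * (a * m)
      factor-re = solve-∀
      factor-im : ∀ a m b c x y U V q r →
        V * (x * (a * m) + y * (b * (b * 1ℤ) - c * (c * 1ℤ) * m))
          - (y * (U * b - V * (c * m)) * c + y * (V * b - U * c) * b) + (q * m * c + r * b) * a
        ≡ (V * x * m + q * m * c + r * b) * a
      factor-im = solve-∀

    -- Comparison with the corner value G.

    re-mono-≤ : ∀ {s t s′ t′} → s ≤ s′ → t ≤ t′ → re m b c s t ≤ re m b c s′ t′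
    re-mono-≤ {s} {t} {s′} {t′} = linear-mono-≤ b (c * m) s s′ t t′

    im-mono-≤ : ∀ {s t s′ t′} → s ≤ s′ → t ≤ t′ → im m b c s t ≤ im m b c s′ t′
    im-mono-≤ {s} {t} {s′} {t′} = linear-mono-≤ c b s s′ t t′

    -- Multiplication by b + c√m is monotone in both coordinates, so λβ ≤ G for every λ in the box.
    -- The difference from λβ is then a multiple of α whose quotients are nonnegative.
    above⇒representable : ∀ {U V} → ReG - a * m < U → ImG - a < V → Representable a m b c U V
    above⇒representable {U} {V} U> V> =
      let s , t , s≤ , t≤ , am∣ , a∣ = β*-surjective-mod-α U V
          y , U≡ = d∣i-l∧i>g-d⇒i≡n*d+l (a * m) ReG U (re m b c (+ s) (+ t)) U> (re-mono-≤ s≤ t≤) am∣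
          x , V≡ = d∣i-l∧i>g-d⇒i≡n*d+l a ImG V (im m b c (+ s) (+ t)) V> (im-mono-≤ s≤ t≤) a∣
      in representation x y s t U≡ V≡

    -- The multiple of α vanishes modulo α, so λβ ≡ G, and cancelling β makes λ congruent to the
    -- corner. As λ has nonnegative coordinates, it dominates the corner; monotonicity carries this
    -- over to λβ and G.
    representable-≡G⇒≥G : ∀ {U V} → Representable a m b c U V →
      a * m ∣ U - ReG → a ∣ V - ImG → ReG ≤ U × ImG ≤ V
    representable-≡G⇒≥G {U} {V} (representation k l s t U≡ V≡) (divides p re≡) (divides q im≡)
      = dominated (a * m) l (re-mono-≤ s≥ t≥) U≡
      , dominated a k (im-mono-≤ s≥ t≥) V≡
      where
      open ≡-Reasoning
      from-G-re : ∀ a m b c s t l → (1ℤ + s) * b + (1ℤ + t) * (c * m)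
        ≡ l * (a * m) + (s * b + t * (c * m)) - ((a * m - 1ℤ) * b + (a - 1ℤ) * (c * m))
          + (b + c - l) * (a * m)
      from-G-re = solve-∀
      from-G-im : ∀ a m b c s t k → (1ℤ + s) * c + (1ℤ + t) * b
        ≡ k * a + (s * c + t * b) - ((a * m - 1ℤ) * c + (a - 1ℤ) * b) + (m * c + b - k) * a
      from-G-im = solve-∀
      factor-re : ∀ d b c p l → p * d + (b + c - l) * d ≡ (p - l + b + c) * d
      factor-re = solve-∀
      factor-im : ∀ a e b q k → q * a + (e + b - k) * a ≡ (q - k + e + b) * a
      factor-im = solve-∀
      -- The corner is congruent to -1 - √m modulo α, so the congruence reads (λ + 1 + √m)β ≡ 0.
      1+λ≡0 = β*-injective-mod-α (1ℤ + + s) (1ℤ + + t)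
        (divides (p - + l + b + c) (begin
          re m b c (1ℤ + + s) (1ℤ + + t) ≡⟨ from-G-re a m b c (+ s) (+ t) (+ l) ⟩
          + l * (a * m) + re m b c (+ s) (+ t) - ReG + (b + c - + l) * (a * m)
            ≡⟨ cong (λ z → z - ReG + (b + c - + l) * (a * m)) U≡ ⟨
          U - ReG + (b + c - + l) * (a * m) ≡⟨ cong (_+ (b + c - + l) * (a * m)) re≡ ⟩
          p * (a * m) + (b + c - + l) * (a * m) ≡⟨ factor-re (a * m) b c p (+ l) ⟩
          (p - + l + b + c) * (a * m) ∎))
        (divides (q - + k + m * c + b) (begin
          im m b c (1ℤ + + s) (1ℤ + + t) ≡⟨ from-G-im a m b c (+ s) (+ t) (+ k) ⟩
          + k * a + im m b c (+ s) (+ t) - ImG + (m * c + b - + k) * a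
            ≡⟨ cong (λ z → z - ImG + (m * c + b - + k) * a) V≡ ⟨
          V - ImG + (m * c + b - + k) * a ≡⟨ cong (_+ (m * c + b - + k) * a) im≡ ⟩
          q * a + (m * c + b - + k) * a ≡⟨ factor-im a (m * c) b q (+ k) ⟩
          (q - + k + m * c + b) * a ∎))
      s≥ = d∣1+n⇒d-1≤n (a * m) s (proj₁ 1+λ≡0)
      t≥ = d∣1+n⇒d-1≤n a t (proj₂ 1+λ≡0)
      -- Adding the nonnegative multiple of α back only raises the coordinates.
      dominated : ∀ d .{{_ : Positive d}} n {g l i} → g ≤ l → i ≡ + n * d + l → g ≤ i
      dominated d n g≤l refl =
        i≤j⇒i≤k+j (+ n * d) {{nonNeg*nonNeg⇒nonNeg (+ n) d {{_}} {{pos⇒nonNeg d}}}} g≤l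

    -- Membership in `Frob` in terms of order: the translate of ℕ[√m] by w + z√m is the quadrant
    -- above (w, z).
    Frobenius : ℤ → ℤ → Set
    Frobenius w z = ∀ {U V} → w ≤ U → z ≤ V → Representable a m b c U V

    -- Otherwise the quadrant contains a point with first coordinate `ReG - a * m` and second
    -- coordinate `ImG + k * a`. It is congruent to G yet falls short of it in the first coordinate,
    -- so it cannot be representable.
    frobenius⇒re> : ∀ {w z} → Frobenius w z → ReG - a * m < w
    frobenius⇒re> {w} {z} frob = ≰⇒> λ w≤ →
      let k , z≤ = ∃-progression≥ a ImG z
          ReG≤ , _ = representable-≡G⇒≥G (frob w≤ z≤)
            (divides -1ℤ (i-d-i≡-1*d ReG (a * m))) (divides k (i+j-i≡j ImG (k * a)))
      in <⇒≱ (i-d<i ReG (a * m)) ReG≤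

    frobenius⇒im> : ∀ {w z} → Frobenius w z → ImG - a < z
    frobenius⇒im> {w} {z} frob = ≰⇒> λ z≤ →
      let k , w≤ = ∃-progression≥ (a * m) ReG w
          _ , ImG≤ = representable-≡G⇒≥G (frob w≤ z≤)
            (divides k (i+j-i≡j ReG (k * (a * m)))) (divides -1ℤ (i-d-i≡-1*d ImG a))
      in <⇒≱ (i-d<i ImG a) ImG≤

-- Passage between ℤ[√m] and coordinates.

open import Defs
open import Data.Nat.Base as ℕ using (ℕ)
open import Data.Integer.Base as ℤ using (+_; 0ℤ; 1ℤ)
open import Data.Integer.GCD using (gcd)
import Data.Integer.Properties as ℤ
open import Data.Integer.Tactic.RingSolver using (solve-∀)
open import Data.Product.Base using (_×_; _,_)
open import Relation.Binary.PropositionalEquality using (_≡_; refl; sym; trans; cong; cong₂; subst)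
open import Relation.Nullary using (¬_)
open import Relation.Unary using (_≐_; _∈_; _⊆_)
open Arithmetic

-- Products of the variables with the literals 0 and 1 do not reduce, so the pair form needs a
-- proof.
u+v√m≡⟨u,v⟩ : ∀ {m} u v → ι {m} u + ι v * √ m ≡ ⟨ + u , + v ⟩
u+v√m≡⟨u,v⟩ {m} u v = cong₂ ⟨_,_⟩ (re-id (+ u) (+ v) (+ m)) (im-id (+ v))
  where
  re-id : ∀ u v m → u ℤ.+ (v ℤ.* 0ℤ ℤ.+ m ℤ.* (0ℤ ℤ.* 1ℤ)) ≡ u
  re-id = solve-∀
  im-id : ∀ v → 0ℤ ℤ.+ (v ℤ.* 1ℤ ℤ.+ 0ℤ ℤ.* 0ℤ) ≡ v
  im-id = solve-∀

v√m≡⟨0,v⟩ : ∀ {m} v → ι {m} v * √ m ≡ ⟨ 0ℤ , + v ⟩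
v√m≡⟨0,v⟩ {m} v = cong₂ ⟨_,_⟩ (re-id (+ v) (+ m)) (im-id (+ v))
  where
  re-id : ∀ v m → v ℤ.* 0ℤ ℤ.+ m ℤ.* (0ℤ ℤ.* 1ℤ) ≡ 0ℤ
  re-id = solve-∀
  im-id : ∀ v → v ℤ.* 1ℤ ℤ.+ 0ℤ ℤ.* 0ℤ ≡ v
  im-id = solve-∀

combination≡ : ∀ {m} a b c x y s t →
  ⟨ x , y ⟩ * (ι {m} a * √ m) + ⟨ s , t ⟩ * (ι b + ι c * √ m)
    ≡ ⟨ y ℤ.* (+ a ℤ.* + m) ℤ.+ re (+ m) (+ b) (+ c) s t , x ℤ.* + a ℤ.+ im (+ m) (+ b) (+ c) s t ⟩
combination≡ {m} a b c x y s t = trans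
  (cong₂ (λ α β → ⟨ x , y ⟩ * α + ⟨ s , t ⟩ * β) (v√m≡⟨0,v⟩ a) (u+v√m≡⟨u,v⟩ b c))
  (cong₂ ⟨_,_⟩ (re-id (+ m) (+ a) (+ b) (+ c) x y s t) (im-id (+ a) (+ b) (+ c) x y s t))
  where
  re-id : ∀ m a b c x y s t → x ℤ.* 0ℤ ℤ.+ m ℤ.* (y ℤ.* a) ℤ.+ (s ℤ.* b ℤ.+ m ℤ.* (t ℤ.* c))
    ≡ y ℤ.* (a ℤ.* m) ℤ.+ (s ℤ.* b ℤ.+ t ℤ.* (c ℤ.* m))
  re-id = solve-∀
  im-id : ∀ a b c x y s t → x ℤ.* a ℤ.+ y ℤ.* 0ℤ ℤ.+ (s ℤ.* c ℤ.+ t ℤ.* b)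
    ≡ x ℤ.* a ℤ.+ (s ℤ.* c ℤ.+ t ℤ.* b)
  im-id = solve-∀

SG⇒representable : ∀ {m a b c U V} → ⟨ U , V ⟩ ∈ SG (ι {m} a * √ m) (ι b + ι c * √ m) →
                   Representable (+ a) (+ m) (+ b) (+ c) U V
SG⇒representable {m} {a} {b} {c} (_ , _ , (x , y , refl) , (s , t , refl) , w≡) =
  representation x y s t (cong ℤ[√_].u coords) (cong ℤ[√_].v coords)
  where
  coords = trans w≡ (trans
    (cong₂ (λ λ₁ λ₂ → λ₁ * (ι a * √ m) + λ₂ * (ι b + ι c * √ m)) (u+v√m≡⟨u,v⟩ x y) (u+v√m≡⟨u,v⟩ s t))
    (combination≡ a b c (+ x) (+ y) (+ s) (+ t)))

representable⇒SG : ∀ {m a b c U V} → Representable (+ a) (+ m) (+ b) (+ c) U V →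
                   ⟨ U , V ⟩ ∈ SG (ι {m} a * √ m) (ι b + ι c * √ m)
representable⇒SG {m} {a} {b} {c} (representation x y s t U≡ V≡) =
  ⟨ + x , + y ⟩ , ⟨ + s , + t ⟩ ,
  (x , y , sym (u+v√m≡⟨u,v⟩ x y)) , (s , t , sym (u+v√m≡⟨u,v⟩ s t)) ,
  trans (cong₂ ⟨_,_⟩ U≡ V≡) (sym (combination≡ a b c (+ x) (+ y) (+ s) (+ t)))

≤⇒∈+ˢℕ[√] : ∀ {m w z U V} → w ℤ.≤ U → z ℤ.≤ V → ⟨ U , V ⟩ ∈ ⟨ w , z ⟩ +ˢ ℕ[√ m ]
≤⇒∈+ˢℕ[√] w≤U z≤V with k , U≡ ← i≤j⇒j≡i+n w≤U | l , V≡ ← i≤j⇒j≡i+n z≤V =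
  ⟨ + k , + l ⟩ , (k , l , sym (u+v√m≡⟨u,v⟩ k l)) , cong₂ ⟨_,_⟩ U≡ V≡

∈+ˢℕ[√]⇒≤ : ∀ {m w z U V} → ⟨ U , V ⟩ ∈ ⟨ w , z ⟩ +ˢ ℕ[√ m ] → w ℤ.≤ U × z ℤ.≤ V
∈+ˢℕ[√]⇒≤ {m} {w} {z} (_ , (k , l , refl) , eq)
  -- Matching identifies `U` with `w ℤ.+ + k` and `V` with `z ℤ.+ + l`.
  with refl ← trans eq (cong (_+_ ⟨ w , z ⟩) (u+v√m≡⟨u,v⟩ k l)) =
  ℤ.i≤i+j w (+ k) , ℤ.i≤i+j z (+ l)

-- The factor (a√m - 1)(1 + √m) equals the corner (am - 1) + (a - 1)√m. Multiplying it by β - 1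
-- gives G minus the corner, which is G - am - a√m with both coordinates raised by one.
generator≡ : ∀ m a b c → let module B = Corner (+ a) (+ m) (+ b) (+ c) in
  (ι a * √ m - ι 1) * (ι b + ι c * √ m - ι 1) * (ι 1 + √ m)
    ≡ ⟨ ℤ.suc (B.ReG ℤ.- + a ℤ.* + m) , ℤ.suc (B.ImG ℤ.- + a) ⟩
generator≡ m a b c = trans
  (cong₂ (λ α β → (α - ι 1) * (β - ι 1) * (ι 1 + √ m)) (v√m≡⟨0,v⟩ a) (u+v√m≡⟨u,v⟩ b c))
  (cong₂ ⟨_,_⟩ (re-id (+ m) (+ a) (+ b) (+ c)) (im-id (+ m) (+ a) (+ b) (+ c)))
  where
  re-id : ∀ m a b c →
    ((0ℤ ℤ.- 1ℤ) ℤ.* (b ℤ.- 1ℤ) ℤ.+ m ℤ.* ((a ℤ.+ 0ℤ) ℤ.* (c ℤ.+ 0ℤ))) ℤ.* 1ℤ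
      ℤ.+ m ℤ.* (((0ℤ ℤ.- 1ℤ) ℤ.* (c ℤ.+ 0ℤ) ℤ.+ (a ℤ.+ 0ℤ) ℤ.* (b ℤ.- 1ℤ)) ℤ.* 1ℤ)
    ≡ 1ℤ ℤ.+ ((a ℤ.* m ℤ.- 1ℤ) ℤ.* b ℤ.+ (a ℤ.- 1ℤ) ℤ.* (c ℤ.* m) ℤ.- a ℤ.* m)
  re-id = solve-∀
  im-id : ∀ m a b c →
    ((0ℤ ℤ.- 1ℤ) ℤ.* (b ℤ.- 1ℤ) ℤ.+ m ℤ.* ((a ℤ.+ 0ℤ) ℤ.* (c ℤ.+ 0ℤ))) ℤ.* 1ℤ
      ℤ.+ ((0ℤ ℤ.- 1ℤ) ℤ.* (c ℤ.+ 0ℤ) ℤ.+ (a ℤ.+ 0ℤ) ℤ.* (b ℤ.- 1ℤ)) ℤ.* 1ℤ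
    ≡ 1ℤ ℤ.+ ((a ℤ.* m ℤ.- 1ℤ) ℤ.* c ℤ.+ (a ℤ.- 1ℤ) ℤ.* b ℤ.- a)
  im-id = solve-∀

-- Both inclusions reduce to the strict bounds `ReG - a * m < w` and `ImG - a < z`; over ℤ these are
-- weak bounds from the successors, hence the `ℤ.suc` in the generator.
Frob≐ : ∀ m a b c .{{_ : ℤ.Positive (+ m)}} .{{_ : ℤ.Positive (+ a)}} x y →
  x ℤ.* (+ a ℤ.* + m) ℤ.+ y ℤ.* ((+ b) ℤ.^ 2 ℤ.- (+ c) ℤ.^ 2 ℤ.* + m) ≡ 1ℤ →
  let open Corner (+ a) (+ m) (+ b) (+ c) in
  Frob (ι {m} a * √ m) (ι b + ι c * √ m)
    ≐ ⟨ ℤ.suc (ReG ℤ.- + a ℤ.* + m) , ℤ.suc (ImG ℤ.- + a) ⟩ +ˢ ℕ[√ m ]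
Frob≐ m a b c x y bézout-norm = Frob⊆ , ⊆Frob
  where
  open Corner (+ a) (+ m) (+ b) (+ c)
  open Box (+ a) (+ m) (+ b) (+ c) x y bézout-norm

  Frob⊆ : Frob (ι {m} a * √ m) (ι b + ι c * √ m)
            ⊆ ⟨ ℤ.suc (ReG ℤ.- + a ℤ.* + m) , ℤ.suc (ImG ℤ.- + a) ⟩ +ˢ ℕ[√ m ]
  Frob⊆ {⟨ w , z ⟩} w∈Frob =
    ≤⇒∈+ˢℕ[√] (ℤ.i<j⇒suc[i]≤j (frobenius⇒re> frob)) (ℤ.i<j⇒suc[i]≤j (frobenius⇒im> frob))
    where
    frob : Frobenius w z
    frob w≤U z≤V = SG⇒representable (w∈Frob (≤⇒∈+ˢℕ[√] w≤U z≤V))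

  ⊆Frob : ⟨ ℤ.suc (ReG ℤ.- + a ℤ.* + m) , ℤ.suc (ImG ℤ.- + a) ⟩ +ˢ ℕ[√ m ]
            ⊆ Frob (ι {m} a * √ m) (ι b + ι c * √ m)
  ⊆Frob {⟨ w , z ⟩} w∈ {⟨ U , V ⟩} U∈ =
    let g≤w , h≤z = ∈+ˢℕ[√]⇒≤ w∈
        w≤U , z≤V = ∈+ˢℕ[√]⇒≤ U∈
    in representable⇒SG (above⇒representable
         (ℤ.suc[i]≤j⇒i<j (ℤ.≤-trans g≤w w≤U)) (ℤ.suc[i]≤j⇒i<j (ℤ.≤-trans h≤z z≤V)))

theorem4 : (m : ℕ) → 0 ℕ.< m → ¬ IsPerfectSquare m →
    (a b c : ℕ) → 0 ℕ.< a → 0 ℕ.< b → 0 ℕ.< c →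
    gcd (+ a ℤ.* + m) ((+ b) ℤ.^ 2 ℤ.- (+ c) ℤ.^ 2 ℤ.* + m) ≡ 1ℤ →
    Frob (ι a * √ m) (ι b + ι c * √ m)
      ≐ ((ι a * √ m - ι 1) * (ι b + ι c * √ m - ι 1) * (ι 1 + √ m)) +ˢ ℕ[√ m ]
theorem4 m 0<m _ a b c 0<a _ _ coprime =
  let x , y , bézout-norm = bézout (+ a ℤ.* + m) ((+ b) ℤ.^ 2 ℤ.- (+ c) ℤ.^ 2 ℤ.* + m) coprime
  in subst (λ g → Frob (ι a * √ m) (ι b + ι c * √ m) ≐ g +ˢ ℕ[√ m ])
       (sym (generator≡ m a b c))
       (Frob≐ m a b c {{ℤ.positive (ℤ.+<+ 0<m)}} {{ℤ.positive (ℤ.+<+ 0<a)}} x y bézout-norm)
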